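{- Let $G$ be a digraph with minimum out-degree $\delta\geq 1200$ and maximum in-degree at most $\frac{\exp(\delta/72)}{12\delta}$. Then $G$ has a majority $3$-colouring. Moreover, the $3$-colouring can be chosen so that, for every vertex $v$ of $G$ and every colour $c\in\{1,2,3\}$, at most half the out-neighbours of $v$ receive colour $c$.
   Context: Digraphs are finite, with no loops and no parallel arcs (a pair of oppositely directed arcs $uv$ and $vu$ is allowed). A majority $3$-colouring of a digraph is a function assigning each vertex one of three colours such that, for each vertex $v$, at most half the out-neighbours of $v$ receive the same colour as $v$. -}

module Defs where

open import Data.Bool.Base using (Bool; false)
open import Data.Fin.Base using (Fin)
open import Data.Fin.Properties using (_≟_)
open import Data.Fin.Subset using (Subset; ∣_∣; _∩_)
open import Data.Integer.Base using (+_)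
open import Data.Nat.Base as ℕ using (ℕ; zero; suc; NonZero; _!)
open import Data.Nat.Properties using (m*n≢0; _!≢0)
open import Data.Product.Base using (_×_; ∃-syntax)
open import Data.Rational.Base as ℚ using (ℚ; 0ℚ; _+_; _*_; _/_)
open import Data.Vec.Base using (tabulate)
open import Relation.Binary.PropositionalEquality.Core using (_≡_)
open import Relation.Nullary.Decidable.Core using (does)

open import Algebra.Definitions.RawSemiring ℚ.+-*-rawSemiring using (_^_)

record Digraph : Set where
  field
    order    : ℕ
    arc      : Fin order → Fin order → Bool
    loopless : ∀ v → arc v v ≡ false

  Vertex : Set
  Vertex = Fin order

  N⁺ : Vertex → Subset order
  N⁺ v = tabulate (λ u → arc v u)

  N⁻ : Vertex → Subset order
  N⁻ v = tabulate (λ u → arc u v)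

  deg⁺ : Vertex → ℕ
  deg⁺ v = ∣ N⁺ v ∣

  deg⁻ : Vertex → ℕ
  deg⁻ v = ∣ N⁻ v ∣

  IsMinOutDegree : ℕ → Set
  IsMinOutDegree δ = (∀ v → δ ℕ.≤ deg⁺ v) × (∃[ v ] deg⁺ v ≡ δ)

  IsMaxInDegree : ℕ → Set
  IsMaxInDegree Δ = (∀ v → deg⁻ v ℕ.≤ Δ) × (∃[ v ] deg⁻ v ≡ Δ)

  Colouring : ℕ → Set
  Colouring k = Vertex → Fin k

  colourClass : ∀ {k} → Colouring k → Fin k → Subset order
  colourClass χ c = tabulate (λ u → does (χ u ≟ c))

  AtMostHalf : ∀ {k} → Colouring k → Vertex → Fin k → Set
  AtMostHalf χ v c = 2 ℕ.* ∣ N⁺ v ∩ colourClass χ c ∣ ℕ.≤ deg⁺ v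

  IsMajority : ∀ {k} → Colouring k → Set
  IsMajority χ = ∀ v → AtMostHalf χ v (χ v)

-- For a convergent sequence a, this is the order relation q ≤ lim a of the
-- real numbers; the real number lim a itself is not constructed.
infix 4 _≤lim_
_≤lim_ : ℚ → (ℕ → ℚ) → Set
q ≤lim a = ∀ ε → 0ℚ ℚ.< ε → ∃[ N ] (∀ n → N ℕ.≤ n → q ℚ.≤ a n + ε)

-- The partial sums Σ_{k<n} xᵏ/k! of the exponential series, so lim (exp x) = eˣ.
exp : ℚ → ℕ → ℚ
exp x zero    = 0ℚ
exp x (suc n) = exp x n + x ^ n * (+ 1 / (n !)) {{n !≢0}}

-- Its limit is exp(δ/72) / (12δ).
inDegreeBound : (δ : ℕ) .{{_ : NonZero δ}} → ℕ → ℚ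
inDegreeBound δ n = exp (+ δ / 72) n * (+ 1 / (12 ℕ.* δ)) {{m*n≢0 12 δ}}

{-# OPTIONS --safe #-}
module Submission where

-- Colour the vertices uniformly at random and call v bad when some colour appears on more than half
-- of N⁺ v, where d = deg⁺ v. By an exponential-moment bound v is bad with probability at most
-- 3 (17/18)ᵈ. Badness of v is independent of the colours outside N⁺ v, and at most d Δ
-- out-neighbourhoods meet N⁺ v, so the Lovász local lemma with the constant weight 1/M, M = 72 Δ, needs
--   3 (17/18)ᵈ ≤ (1/M) (1 − 1/M)^(d Δ).
-- By Bernoulli (1 − 1/M)^Δ ≥ 71/72, and exp (δ/72) ≤ (72/71)^δ turns the in-degree hypothesis into
-- 3 M ≤ (72/71)ᵈ; the inequality then reduces to 17 · 72² ≤ 18 · 71². Probabilities are counts over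
-- all colourings, and the existential is a search through the finitely many of them.

open import Defs
open import Data.Bool.Base using (Bool; true; false; not; if_then_else_)
open import Data.Fin.Base using (Fin; zero; suc)
import Data.Fin.Properties as Fin
open import Data.Fin.Subset using (Subset; Nonempty; _∈_; _∉_; ∣_∣; _∩_)
open import Data.Fin.Subset.Properties using (nonempty?; x∈p∩q⁺; x∈p⇒∣p-x∣<∣p∣; Empty-unique; ∣⊥∣≡0)
open import Data.Integer.Base as ℤ using (+_)
import Data.Integer.Properties as ℤ
open import Data.Integer.Tactic.RingSolver using () renaming (solve-∀ to solveℤ-∀)
open import Data.List.Base as List using (List; []; _∷_; _++_; length; filter; allFin)
open import Data.List.Membership.Propositional using () renaming (_∈_ to _∈ᴸ_)
open import Data.List.Membership.Propositional.Properties using (∈-allFin)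
open import Data.List.Properties using (map-++; map-tabulate)
open import Data.List.Relation.Binary.Permutation.Propositional using (_↭_; prep; ↭-refl; ↭-sym; ↭-trans)
open import Data.List.Relation.Binary.Permutation.Propositional.Properties using (↭-length; map⁺; shift; ++-identityʳ)
open import Data.List.Relation.Unary.All using (All; []; _∷_)
open import Data.List.Relation.Unary.All.Properties using (all-filter)
open import Data.List.Relation.Unary.Any using (here; there)
open import Data.Nat.Base as ℕ hiding (_/_)
open import Data.Nat.ListAction using (product) renaming (sum to sumᴸ)
open import Data.Nat.ListAction.Properties using (sum-++; sum-↭; product-++; product-↭)
open import Data.Nat.Properties as ℕ
open import Data.Nat.Tactic.RingSolver using (solve-∀)
open import Data.Product.Base using (_×_; _,_; map₂; ∃-syntax)
open import Data.Rational.Base as ℚ using (ℚ; 0ℚ; 1ℚ; _/_; fromℚᵘ; toℚᵘ)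
import Data.Rational.Properties as ℚ
open import Data.Rational.Solver using (module +-*-Solver)
open import Data.Rational.Unnormalised.Base as ℚᵘ using (mkℚᵘ; *≡*; *≤*)
import Data.Rational.Unnormalised.Properties as ℚᵘ
open import Data.Vec.Base using (Vec; []; _∷_; lookup; tabulate; here; there)
open import Data.Vec.Properties using (lookup⇒[]=; []=⇒lookup; lookup∘tabulate)
open import Function.Base using (_∘_; id; it)
open import Function.Bundles using (mk⇔)
open import Relation.Binary.PropositionalEquality
open import Relation.Nullary using (¬_; Dec; yes; no; does; contradiction)
open import Relation.Nullary.Decidable using (does-⇔)
open import Relation.Unary using (Decidable; Pred)
open import Relation.Unary.Properties using (∁?)

open import Algebra.Definitions.RawSemiring ℚ.+-*-rawSemiring using () renaming (_^_ to _^ℚ_)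
open import Algebra.Properties.CommutativeSemigroup *-commutativeSemigroup
  using (x∙yz≈y∙xz) renaming (interchange to *-interchange)
open import Algebra.Properties.Semiring.Sum +-*-semiring

-- Sums over all colourings

𝟙 : Bool → ℕ
𝟙 b = if b then 1 else 0

𝟙≤1 : ∀ b → 𝟙 b ≤ 1
𝟙≤1 true  = ≤-refl
𝟙≤1 false = z≤n

sum-mono : ∀ {k} {f g : Fin k → ℕ} → (∀ c → f c ≤ g c) → sum f ≤ sum g
sum-mono {zero}  f≤g = z≤n
sum-mono {suc k} f≤g = +-mono-≤ (f≤g zero) (sum-mono (f≤g ∘ suc))

sum-const : ∀ k x → sum {k} (λ _ → x) ≡ k * x
sum-const zero    x = refl
sum-const (suc k) x = cong (λ t → x + t) (sum-const k x)

-- Divided by k ^ n, this is the expectation of f under a uniformly random colouring. Colourings are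
-- vectors here so that sums and searches recurse on the vertices.
total : ∀ {k n} → (Vec (Fin k) n → ℕ) → ℕ
total {n = zero}  f = f []
total {n = suc n} f = sum (λ c → total (λ χ → f (c ∷ χ)))

total-cong : ∀ {k n} {f g : Vec (Fin k) n → ℕ} → (∀ χ → f χ ≡ g χ) → total f ≡ total g
total-cong {n = zero}  f≗g = f≗g []
total-cong {n = suc n} f≗g = sum-cong-≗ (λ c → total-cong (λ χ → f≗g (c ∷ χ)))

total-mono : ∀ {k n} {f g : Vec (Fin k) n → ℕ} → (∀ χ → f χ ≤ g χ) → total f ≤ total g
total-mono {n = zero}  f≤g = f≤g []
total-mono {n = suc n} f≤g = sum-mono (λ c → total-mono (λ χ → f≤g (c ∷ χ)))

total-+ : ∀ {k n} (f g : Vec (Fin k) n → ℕ) → total (λ χ → f χ + g χ) ≡ total f + total g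
total-+ {n = zero}  f g = refl
total-+ {n = suc n} f g = trans
  (sum-cong-≗ (λ c → total-+ (λ χ → f (c ∷ χ)) (λ χ → g (c ∷ χ))))
  (∑-distrib-+ (λ c → total (λ χ → f (c ∷ χ))) (λ c → total (λ χ → g (c ∷ χ))))

total-* : ∀ {k n} a (f : Vec (Fin k) n → ℕ) → total (λ χ → a * f χ) ≡ a * total f
total-* {n = zero}  a f = refl
total-* {n = suc n} a f = trans
  (sum-cong-≗ (λ c → total-* a (λ χ → f (c ∷ χ))))
  (sym (*-distribˡ-sum a (λ c → total (λ χ → f (c ∷ χ)))))

sum-∃ : ∀ {k} (f : Fin k → ℕ) → 0 < sum f → ∃[ c ] 0 < f c
sum-∃ {suc k} f 0<Σ with f zero in eq
... | suc _ = zero , subst (0 <_) (sym eq) z<s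
... | zero  with c , 0<fc ← sum-∃ (f ∘ suc) 0<Σ = suc c , 0<fc

-- The probabilistic method made constructive: a positive sum has a positive slice, and descending
-- through the slices reaches an explicit colouring.
total-∃ : ∀ {k n} (f : Vec (Fin k) n → ℕ) → 0 < total f → ∃[ χ ] 0 < f χ
total-∃ {n = zero}  f 0<Σ = [] , 0<Σ
total-∃ {n = suc n} f 0<Σ with c , 0<Σ′ ← sum-∃ _ 0<Σ with χ , 0<f ← total-∃ _ 0<Σ′ = c ∷ χ , 0<f

total-1>0 : ∀ {k n} → .{{NonZero k}} → 0 < total {k} {n} (λ _ → 1)
total-1>0 {suc k} {zero}  = z<s
total-1>0 {suc k} {suc n} = ≤-trans (total-1>0 {suc k} {n}) (m≤m+n _ _)

-- Independence of disjoint sets of vertices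

AgreeOn AgreeOff : ∀ {k n} → Subset n → Vec (Fin k) n → Vec (Fin k) n → Set
AgreeOn  D χ χ′ = ∀ {i} → i ∈ D → lookup χ i ≡ lookup χ′ i
AgreeOff D χ χ′ = ∀ {i} → i ∉ D → lookup χ i ≡ lookup χ′ i

Ignores : ∀ {k n} → Subset n → (Vec (Fin k) n → ℕ) → Set
Ignores D g = ∀ χ χ′ → AgreeOff D χ χ′ → g χ ≡ g χ′

ignores-∷ : ∀ {k n b} {D : Subset n} {g : Vec (Fin k) (suc n) → ℕ} →
            Ignores (b ∷ D) g → ∀ c → Ignores D (λ χ → g (c ∷ χ))
ignores-∷ {D = D} ign c χ χ′ agree = ign (c ∷ χ) (c ∷ χ′) agree-∷
  where
  agree-∷ : AgreeOff (_ ∷ D) (c ∷ χ) (c ∷ χ′)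
  agree-∷ {zero}  _    = refl
  agree-∷ {suc i} si∉D = agree (λ i∈D → si∉D (there i∈D))

weight : ∀ {k n} → (Fin k → ℕ) → Subset n → Vec (Fin k) n → ℕ
weight w []          []      = 1
weight w (true  ∷ D) (c ∷ χ) = w c * weight w D χ
weight w (false ∷ D) (c ∷ χ) = weight w D χ

-- Independence, cleared of denominators: the colours on `D` are independent of each other and of
-- `g`, so the expectation of the product of w over `D` times g is (sum w / k) ^ ∣ D ∣ times that of
-- g.
total-weight : ∀ {k n} (w : Fin k → ℕ) (D : Subset n) {g : Vec (Fin k) n → ℕ} → Ignores D g →
               k ^ ∣ D ∣ * total (λ χ → weight w D χ * g χ) ≡ sum w ^ ∣ D ∣ * total g
total-weight w [] ign = cong (1 *_) (*-identityˡ _)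
total-weight {k} w (false ∷ D) {g} ign = begin
  k ^ ∣ D ∣ * sum (λ c → total (λ χ → weight w D χ * g (c ∷ χ)))
    ≡⟨ *-distribˡ-sum (k ^ ∣ D ∣) (λ c → total (λ χ → weight w D χ * g (c ∷ χ))) ⟩
  sum (λ c → k ^ ∣ D ∣ * total (λ χ → weight w D χ * g (c ∷ χ)))
    ≡⟨ sum-cong-≗ (λ c → total-weight w D (ignores-∷ {g = g} ign c)) ⟩
  sum (λ c → sum w ^ ∣ D ∣ * total (λ χ → g (c ∷ χ)))
    ≡⟨ *-distribˡ-sum (sum w ^ ∣ D ∣) (λ c → total (λ χ → g (c ∷ χ))) ⟨
  sum w ^ ∣ D ∣ * sum (λ c → total (λ χ → g (c ∷ χ))) ∎
  where open ≡-Reasoning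
total-weight {k} w (true ∷ D) {g} ign = begin
  k * K * sum (λ c → total (λ χ → w c * weight w D χ * g (c ∷ χ)))
    ≡⟨ *-assoc k K _ ⟩
  k * (K * sum (λ c → total (λ χ → w c * weight w D χ * g (c ∷ χ))))
    ≡⟨ cong (k *_) (*-distribˡ-sum K (λ c → total (λ χ → w c * weight w D χ * g (c ∷ χ)))) ⟩
  k * sum (λ c → K * total (λ χ → w c * weight w D χ * g (c ∷ χ)))
    ≡⟨ cong (k *_) (sum-cong-≗ slice) ⟩
  k * sum (λ c → w c * (W * T c))
    -- The factor k becomes a sum over a second colour c′. As the first vertex lies in the ignored
    -- set, `T c` may be replaced by `T c′`, and the double sum factorises.
    ≡⟨ sum-const k _ ⟨
  sum {k} (λ c′ → sum (λ c → w c * (W * T c)))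
    ≡⟨ sum-cong-≗ (λ c′ → sum-cong-≗ (λ c → cong (λ t → w c * (W * t)) (T-const c c′))) ⟩
  sum (λ c′ → sum (λ c → w c * (W * T c′)))
    ≡⟨ sum-cong-≗ (λ c′ → sym (*-distribʳ-sum (W * T c′) w)) ⟩
  sum (λ c′ → sum w * (W * T c′))
    ≡⟨ sum-cong-≗ (λ c′ → sym (*-assoc (sum w) W (T c′))) ⟩
  sum (λ c′ → sum w * W * T c′)
    ≡⟨ *-distribˡ-sum (sum w * W) T ⟨
  sum w * W * sum T ∎
  where
  open ≡-Reasoning
  K = k ^ ∣ D ∣
  W = sum w ^ ∣ D ∣
  T : Fin k → ℕ
  T c = total (λ χ → g (c ∷ χ))
  T-const : ∀ c c′ → T c ≡ T c′
  T-const c c′ = total-cong λ χ → ign (c ∷ χ) (c′ ∷ χ) (agree χ)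
    where
    agree : ∀ χ → AgreeOff (true ∷ D) (c ∷ χ) (c′ ∷ χ)
    agree χ {zero}  0∉D = contradiction here 0∉D
    agree χ {suc i} _   = refl
  slice : ∀ c → K * total (λ χ → w c * weight w D χ * g (c ∷ χ)) ≡ w c * (W * T c)
  slice c = begin
    K * total (λ χ → w c * weight w D χ * g (c ∷ χ))
      ≡⟨ cong (K *_) (total-cong λ χ → *-assoc (w c) (weight w D χ) (g (c ∷ χ))) ⟩
    K * total (λ χ → w c * (weight w D χ * g (c ∷ χ)))
      ≡⟨ cong (K *_) (total-* (w c) (λ χ → weight w D χ * g (c ∷ χ))) ⟩
    K * (w c * total (λ χ → weight w D χ * g (c ∷ χ)))
      ≡⟨ x∙yz≈y∙xz K (w c) _ ⟩
    w c * (K * total (λ χ → weight w D χ * g (c ∷ χ)))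
      ≡⟨ cong (w c *_) (total-weight w D (ignores-∷ {g = g} ign c)) ⟩
    w c * (W * T c) ∎

-- Splitting a list by a predicate

filter-split-↭ : ∀ {a p} {A : Set a} {P : Pred A p} (P? : Decidable P) (xs : List A) →
                 xs ↭ filter P? xs ++ filter (∁? P?) xs
filter-split-↭ P? [] = ↭-refl
filter-split-↭ P? (x ∷ xs) with P? x
... | yes _ = prep x (filter-split-↭ P? xs)
... | no  _ = ↭-trans (prep x (filter-split-↭ P? xs)) (↭-sym (shift x _ _))

length-filter-𝟙 : ∀ {a p} {A : Set a} {P : Pred A p} (P? : Decidable P) (xs : List A) →
                  length (filter P? xs) ≡ sumᴸ (List.map (λ x → 𝟙 (does (P? x))) xs)
length-filter-𝟙 P? [] = refl
length-filter-𝟙 P? (x ∷ xs) with P? x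
... | yes _ = cong suc (length-filter-𝟙 P? xs)
... | no  _ = length-filter-𝟙 P? xs

-- Lovász local lemma

-- The weight of every bad event is x = 1 / (m + 1), and `rare` is the condition Pr ≤ x (1 - x) ^ a
-- i without denominators. Quantifying over every g that ignores `scope i` builds in the
-- independence from the events whose scopes are disjoint from it.
module LocalLemma
  {k n : ℕ} {I : Set} (scope : I → Subset n) (ok : I → Vec (Fin k) n → Bool)
  (ok-local : ∀ i χ χ′ → AgreeOn (scope i) χ χ′ → ok i χ ≡ ok i χ′)
  (m : ℕ) (a : I → ℕ)
  (rare : ∀ i {g} → Ignores (scope i) g →
          suc m * suc m ^ a i * total (λ χ → 𝟙 (not (ok i χ)) * g χ) ≤ m ^ a i * total g)
  where

  meets? : ∀ i j → Dec (Nonempty (scope i ∩ scope j))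
  meets? i j = nonempty? (scope i ∩ scope j)

  crowd : I → List I → ℕ
  crowd i S = sumᴸ (List.map (λ j → 𝟙 (does (meets? i j))) S)

  allOk : List I → Vec (Fin k) n → ℕ
  allOk S χ = product (List.map (λ j → 𝟙 (ok j χ)) S)

  Sparse : List I → Set
  Sparse S = ∀ i → crowd i S ≤ a i

  sparse-++ʳ : ∀ S {T} → Sparse (S ++ T) → Sparse T
  sparse-++ʳ S {T} sparse i = ≤-trans (m≤n+m _ (crowd i S)) (subst (_≤ a i)
    (trans (cong sumᴸ (map-++ _ S T)) (sum-++ (List.map _ S) _)) (sparse i))

  sparse-↭ : ∀ {S T} → S ↭ T → Sparse S → Sparse T
  sparse-↭ S↭T sparse i = subst (_≤ a i) (sum-↭ (map⁺ _ S↭T)) (sparse i)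

  allOk-++ : ∀ S T χ → allOk (S ++ T) χ ≡ allOk S χ * allOk T χ
  allOk-++ S T χ = trans (cong product (map-++ _ S T)) (product-++ (List.map _ S) _)

  allOk-↭ : ∀ {S T} → S ↭ T → ∀ χ → allOk S χ ≡ allOk T χ
  allOk-↭ S↭T χ = product-↭ (map⁺ _ S↭T)

  allOk≤1 : ∀ S χ → allOk S χ ≤ 1
  allOk≤1 []      χ = ≤-refl
  allOk≤1 (i ∷ S) χ = *-mono-≤ (𝟙≤1 (ok i χ)) (allOk≤1 S χ)

  allOk-ignores : ∀ i {S} → All (λ j → ¬ Nonempty (scope i ∩ scope j)) S → Ignores (scope i) (allOk S)
  allOk-ignores i []             χ χ′ agree = refl
  allOk-ignores i (¬meet ∷ rest) χ χ′ agree = cong₂ (λ b p → 𝟙 b * p)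
    (ok-local _ χ χ′ λ u∈j → agree λ u∈i → ¬meet (_ , x∈p∩q⁺ (u∈i , u∈j)))
    (allOk-ignores i rest χ χ′ agree)

  -- The inductive claim of the local lemma: conditioned on all events of S being good, i is bad
  -- with probability at most 1 / (m + 1). It is multiplied out, so no conditioning on a null event
  -- can arise.
  Unlikely : I → List I → Set
  Unlikely i S = suc m * total (λ χ → 𝟙 (not (ok i χ)) * allOk S χ) ≤ total (allOk S)

  total-allOk-∷ : ∀ i S → total (allOk S) ≡
                  total (λ χ → 𝟙 (not (ok i χ)) * allOk S χ) + total (allOk (i ∷ S))
  total-allOk-∷ i S = trans (total-cong cases) (total-+ (λ χ → 𝟙 (not (ok i χ)) * allOk S χ) (allOk (i ∷ S)))
    where
    cases : ∀ χ → allOk S χ ≡ 𝟙 (not (ok i χ)) * allOk S χ + 𝟙 (ok i χ) * allOk S χ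
    cases χ with ok i χ
    ... | true  = sym (+-identityʳ _)
    ... | false = sym (trans (+-identityʳ _) (*-identityˡ _))

  -- The complement of `Unlikely`: i stays good with conditional probability at least m / (m + 1).
  -- Adding `N` to both sides avoids subtraction.
  keep : ∀ i S → Unlikely i S → m * total (allOk S) ≤ suc m * total (allOk (i ∷ S))
  keep i S unl = +-cancelˡ-≤ N _ _ (begin
    N + m * N                                    ≡⟨ cong (suc m *_) (total-allOk-∷ i S) ⟩
    suc m * (B + total (allOk (i ∷ S)))          ≡⟨ *-distribˡ-+ (suc m) B (total (allOk (i ∷ S))) ⟩
    suc m * B + suc m * total (allOk (i ∷ S))    ≤⟨ +-monoˡ-≤ _ unl ⟩
    N + suc m * total (allOk (i ∷ S))            ∎)
    where
    open ≤-Reasoning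
    N = total (allOk S)
    B = total (λ χ → 𝟙 (not (ok i χ)) * allOk S χ)

  -- ℓ bounds the length of the lists and carries the mutual recursion.
  unlikely : ∀ ℓ S → length S ≤ ℓ → Sparse S → ∀ i → Unlikely i S
  strip : ∀ ℓ S T → length (S ++ T) ≤ ℓ → Sparse (S ++ T) →
          m ^ length S * total (allOk T) ≤ suc m ^ length S * total (allOk (S ++ T))

  unlikely ℓ S len sparse i = *-cancelˡ-≤ (suc m ^ a i) {{m^n≢0 (suc m) (a i)}} (begin
    suc m ^ a i * (suc m * total (λ χ → 𝟙 (not (ok i χ)) * allOk S χ))
      -- Dropping the conditions that meet `scope i` can only enlarge the count; what remains
      -- ignores `scope i`, so `rare` applies.
      ≤⟨ *-monoʳ-≤ (suc m ^ a i) (*-monoʳ-≤ (suc m) (total-mono λ χ → *-monoʳ-≤ (𝟙 (not (ok i χ))) (drop-near χ))) ⟩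
    suc m ^ a i * (suc m * total (λ χ → 𝟙 (not (ok i χ)) * allOk far χ))
      ≡⟨ reorder (suc m ^ a i) (suc m) _ ⟩
    suc m * suc m ^ a i * total (λ χ → 𝟙 (not (ok i χ)) * allOk far χ)
      ≤⟨ rare i (allOk-ignores i (all-filter (∁? (meets? i)) S)) ⟩
    m ^ a i * total (allOk far)
      ≡⟨ cong (λ e → m ^ e * total (allOk far)) a-split ⟩
    m ^ (r + length near) * total (allOk far)
      ≡⟨ cong (_* total (allOk far)) (^-distribˡ-+-* m r (length near)) ⟩
    m ^ r * m ^ length near * total (allOk far)
      ≡⟨ *-assoc (m ^ r) _ _ ⟩
    m ^ r * (m ^ length near * total (allOk far))
      -- The dropped conditions are restored by `strip` at a cost of m / (m + 1) each. Sparsity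
      -- provides at least that many factors, and the r spare ones are absorbed by m ≤ m + 1.
      ≤⟨ *-mono-≤ (^-monoˡ-≤ r (n≤1+n m))
           (strip ℓ near far (subst (_≤ ℓ) (↭-length split) len) (sparse-↭ split sparse)) ⟩
    suc m ^ r * (suc m ^ length near * total (allOk (near ++ far)))
      ≡⟨ *-assoc (suc m ^ r) _ _ ⟨
    suc m ^ r * suc m ^ length near * total (allOk (near ++ far))
      ≡⟨ cong (_* total (allOk (near ++ far))) (^-distribˡ-+-* (suc m) r (length near)) ⟨
    suc m ^ (r + length near) * total (allOk (near ++ far))
      ≡⟨ cong₂ (λ e x → suc m ^ e * x) a-split (total-cong (allOk-↭ split)) ⟨
    suc m ^ a i * total (allOk S) ∎)
    where
    open ≤-Reasoning
    near far : List I
    near = filter (meets? i) S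
    far  = filter (∁? (meets? i)) S
    split : S ↭ near ++ far
    split = filter-split-↭ (meets? i) S
    r = a i ∸ length near
    a-split : a i ≡ r + length near
    a-split = sym (m∸n+n≡m (subst (_≤ a i) (sym (length-filter-𝟙 (meets? i) S)) (sparse i)))
    drop-near : ∀ χ → allOk S χ ≤ allOk far χ
    drop-near χ = subst₂ _≤_ (sym (trans (allOk-↭ split χ) (allOk-++ near far χ)))
      (*-identityˡ _) (*-monoˡ-≤ (allOk far χ) (allOk≤1 near χ))
    reorder : ∀ x y z → x * (y * z) ≡ y * x * z
    reorder = solve-∀

  strip ℓ       []      T len       sparse = ≤-refl
  strip (suc ℓ) (i ∷ S) T (s≤s len) sparse = begin
    m * m ^ length S * total (allOk T)
      ≡⟨ *-assoc m _ _ ⟩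
    m * (m ^ length S * total (allOk T))
      ≤⟨ *-monoʳ-≤ m (strip ℓ S T len sparse′) ⟩
    m * (suc m ^ length S * total (allOk (S ++ T)))
      ≡⟨ swap m (suc m ^ length S) _ ⟩
    suc m ^ length S * (m * total (allOk (S ++ T)))
      -- Chain rule: adding i costs one more factor m / (m + 1), by the estimate for the shorter
      -- list `S ++ T`.
      ≤⟨ *-monoʳ-≤ (suc m ^ length S) (keep i (S ++ T) (unlikely ℓ (S ++ T) len sparse′ i)) ⟩
    suc m ^ length S * (suc m * total (allOk (i ∷ S ++ T)))
      ≡⟨ reorder (suc m ^ length S) (suc m) _ ⟩
    suc m * suc m ^ length S * total (allOk (i ∷ S ++ T)) ∎
    where
    open ≤-Reasoning
    sparse′ = sparse-++ʳ List.[ i ] {S ++ T} sparse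
    swap : ∀ x y z → x * (y * z) ≡ y * (x * z)
    swap = solve-∀
    reorder : ∀ x y z → x * (y * z) ≡ y * x * z
    reorder = solve-∀

  allOk-∈ : ∀ {i} S χ → i ∈ᴸ S → 0 < allOk S χ → ok i χ ≡ true
  allOk-∈ (i ∷ S) χ i∈S 0<p with ok i χ in eq
  allOk-∈ (i ∷ S) χ (here refl) 0<p | true = eq
  allOk-∈ (i ∷ S) χ (there i∈S) 0<p | true = allOk-∈ S χ i∈S (subst (0 <_) (*-identityˡ _) 0<p)

  -- With T empty, `strip` leaves at least the fraction (m / (m + 1)) ^ length S of all colourings,
  -- which is positive because m is nonzero.
  total-allOk>0 : .{{NonZero k}} → .{{NonZero m}} → ∀ S → Sparse S → 0 < total (allOk S)
  total-allOk>0 S sparse = *-cancelˡ-< (suc m ^ length S) 0 _ (begin-strict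
    suc m ^ length S * 0
      ≡⟨ *-zeroʳ (suc m ^ length S) ⟩
    0
      <⟨ *-mono-< (m^n>0 m (length S)) (total-1>0 {k} {n}) ⟩
    m ^ length S * total (allOk [])
      ≤⟨ strip (length (S ++ [])) S [] ≤-refl (sparse-↭ S↭S++[] sparse) ⟩
    suc m ^ length S * total (allOk (S ++ []))
      ≡⟨ cong (suc m ^ length S *_) (total-cong (allOk-↭ S↭S++[])) ⟨
    suc m ^ length S * total (allOk S) ∎)
    where
    open ≤-Reasoning
    S↭S++[] : S ↭ S ++ []
    S↭S++[] = ↭-sym (++-identityʳ S)

  avoid-all : .{{NonZero k}} → .{{NonZero m}} → ∀ S → Sparse S → ∃[ χ ] (∀ {i} → i ∈ᴸ S → ok i χ ≡ true)
  avoid-all S sparse with χ , 0<p ← total-∃ (allOk S) (total-allOk>0 S sparse) =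
    χ , λ i∈S → allOk-∈ S χ i∈S 0<p

-- Upper bound for the exponential

fromℚᵘ-homo-+ : ∀ p q → fromℚᵘ p ℚ.+ fromℚᵘ q ≡ fromℚᵘ (p ℚᵘ.+ q)
fromℚᵘ-homo-+ p q = ℚ.toℚᵘ-injective (begin
  toℚᵘ (fromℚᵘ p ℚ.+ fromℚᵘ q)          ≈⟨ ℚ.toℚᵘ-homo-+ (fromℚᵘ p) (fromℚᵘ q) ⟩
  toℚᵘ (fromℚᵘ p) ℚᵘ.+ toℚᵘ (fromℚᵘ q)  ≈⟨ ℚᵘ.+-cong (ℚ.toℚᵘ-fromℚᵘ p) (ℚ.toℚᵘ-fromℚᵘ q) ⟩
  p ℚᵘ.+ q                              ≈⟨ ℚ.toℚᵘ-fromℚᵘ (p ℚᵘ.+ q) ⟨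
  toℚᵘ (fromℚᵘ (p ℚᵘ.+ q))              ∎)
  where open ℚᵘ.≃-Reasoning

fromℚᵘ-homo-* : ∀ p q → fromℚᵘ p ℚ.* fromℚᵘ q ≡ fromℚᵘ (p ℚᵘ.* q)
fromℚᵘ-homo-* p q = ℚ.toℚᵘ-injective (begin
  toℚᵘ (fromℚᵘ p ℚ.* fromℚᵘ q)          ≈⟨ ℚ.toℚᵘ-homo-* (fromℚᵘ p) (fromℚᵘ q) ⟩
  toℚᵘ (fromℚᵘ p) ℚᵘ.* toℚᵘ (fromℚᵘ q)  ≈⟨ ℚᵘ.*-cong (ℚ.toℚᵘ-fromℚᵘ p) (ℚ.toℚᵘ-fromℚᵘ q) ⟩
  p ℚᵘ.* q                              ≈⟨ ℚ.toℚᵘ-fromℚᵘ (p ℚᵘ.* q) ⟨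
  toℚᵘ (fromℚᵘ (p ℚᵘ.* q))              ∎)
  where open ℚᵘ.≃-Reasoning

ι : ℕ → ℚ
ι n = + n / 1

/-suc : ∀ n d .{{_ : ℕ.NonZero d}} → + suc n / d ≡ + n / d ℚ.+ + 1 / d
/-suc n (suc d) = sym (trans (fromℚᵘ-homo-+ p q)
  (ℚ.fromℚᵘ-cong {p ℚᵘ.+ q} {mkℚᵘ (+ suc n) d} (*≡* (eq (+ n) (+ suc d)))))
  where
  p = mkℚᵘ (+ n) d
  q = mkℚᵘ (+ 1) d
  eq : ∀ x y → (x ℤ.* y ℤ.+ + 1 ℤ.* y) ℤ.* y ≡ (+ 1 ℤ.+ x) ℤ.* (y ℤ.* y)
  eq = solveℤ-∀

ι-* : ∀ m n → ι (m ℕ.* n) ≡ ι m ℚ.* ι n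
ι-* m n = sym (trans (fromℚᵘ-homo-* (mkℚᵘ (+ m) 0) (mkℚᵘ (+ n) 0)) (cong (_/ 1) (sym (ℤ.pos-* m n))))

ι-cancel-≤ : ∀ {m n} → ι m ℚ.≤ ι n → m ℕ.≤ n
ι-cancel-≤ {m} {n} ιm≤ιn with ℚᵘ.≤-respˡ-≃ (ℚ.toℚᵘ-fromℚᵘ (mkℚᵘ (+ m) 0))
  (ℚᵘ.≤-respʳ-≃ (ℚ.toℚᵘ-fromℚᵘ (mkℚᵘ (+ n) 0)) (ℚ.toℚᵘ-mono-≤ ιm≤ιn))
... | *≤* m*1≤n*1 = ℤ.drop‿+≤+ (subst₂ ℤ._≤_ (ℤ.*-identityʳ (+ m)) (ℤ.*-identityʳ (+ n)) m*1≤n*1)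

ι-*-1/ : ∀ m n .{{_ : ℕ.NonZero m}} .{{_ : ℕ.NonZero n}} →
         ι m ℚ.* (+ 1 / (m ℕ.* n)) {{ℕ.m*n≢0 m n}} ≡ + 1 / n
ι-*-1/ (suc m) (suc n) = trans (fromℚᵘ-homo-* p q) (ℚ.fromℚᵘ-cong {p ℚᵘ.* q} {mkℚᵘ (+ 1) n} (*≡* (trans
  (eq (+ suc m) (+ suc n))
  (cong (λ d → + 1 ℤ.* (+ 1 ℤ.* d)) (sym (ℤ.pos-* (suc m) (suc n)))))))
  where
  p = mkℚᵘ (+ suc m) 0
  q = mkℚᵘ (+ 1) (n ℕ.+ m ℕ.* suc n)
  eq : ∀ x y → x ℤ.* + 1 ℤ.* y ≡ + 1 ℤ.* (+ 1 ℤ.* (x ℤ.* y))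
  eq = solveℤ-∀

0≤/ : ∀ n d .{{_ : ℕ.NonZero d}} → 0ℚ ℚ.≤ + n / d
0≤/ n d = ℚ.nonNegative⁻¹ (+ n / d) {{ℚ.normalize-nonNeg n d}}

0≤+ : ∀ {p q} → 0ℚ ℚ.≤ p → 0ℚ ℚ.≤ q → 0ℚ ℚ.≤ p ℚ.+ q
0≤+ = ℚ.+-mono-≤

0≤* : ∀ {p q} → 0ℚ ℚ.≤ p → 0ℚ ℚ.≤ q → 0ℚ ℚ.≤ p ℚ.* q
0≤* {p} {q} 0≤p 0≤q = subst (ℚ._≤ p ℚ.* q) (ℚ.*-zeroʳ p) (ℚ.*-monoˡ-≤-nonNeg p {{ℚ.nonNegative 0≤p}} 0≤q)

0≤^ : ∀ {p} n → 0ℚ ℚ.≤ p → 0ℚ ℚ.≤ p ^ℚ n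
0≤^ zero    0≤p = 0≤/ 1 1
0≤^ (suc n) 0≤p = 0≤* 0≤p (0≤^ n 0≤p)

p≤p+q : ∀ p {q} → 0ℚ ℚ.≤ q → p ℚ.≤ p ℚ.+ q
p≤p+q p 0≤q = subst (ℚ._≤ p ℚ.+ _) (ℚ.+-identityʳ p) (ℚ.+-monoʳ-≤ p 0≤q)

1/!-suc : ∀ k → ι (suc k) ℚ.* (+ 1 / (suc k !)) {{suc k ℕ.!≢0}} ≡ (+ 1 / (k !)) {{k ℕ.!≢0}}
1/!-suc k = ι-*-1/ (suc k) (k !) {{_}} {{k ℕ.!≢0}}

module _ {x h : ℚ} (0≤x : 0ℚ ℚ.≤ x) (0≤h : 0ℚ ℚ.≤ h) where

  open ℚ.≤-Reasoning
  open +-*-Solver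

  private
    y : ℚ
    y = x ℚ.+ h

    0≤y : 0ℚ ℚ.≤ y
    0≤y = 0≤+ 0≤x 0≤h

  -- A mean value estimate: the derivative (k + 1) tᵏ on [x, y] is largest at the right end y.
  ^-increment : ∀ k → y ^ℚ suc k ℚ.≤ x ^ℚ suc k ℚ.+ ι (suc k) ℚ.* (h ℚ.* y ^ℚ k)
  ^-increment zero = ℚ.≤-reflexive (solve 2 (λ x h → (x :+ h) :* con 1ℚ := x :* con 1ℚ :+ con 1ℚ :* (h :* con 1ℚ)) refl x h)
  ^-increment (suc k) = begin
    (x ℚ.+ h) ℚ.* Y
      ≡⟨ ℚ.*-distribʳ-+ Y x h ⟩
    x ℚ.* Y ℚ.+ h ℚ.* Y
      ≤⟨ ℚ.+-monoˡ-≤ (h ℚ.* Y) (ℚ.*-monoˡ-≤-nonNeg x {{ℚ.nonNegative 0≤x}} (^-increment k)) ⟩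
    x ℚ.* (X ℚ.+ n ℚ.* (h ℚ.* y ^ℚ k)) ℚ.+ h ℚ.* Y
      -- The added nonnegative term completes x to x + h = y in the product n h x yᵏ.
      ≤⟨ p≤p+q _ (0≤* (0≤/ (suc k) 1) (0≤* 0≤h (0≤* 0≤h (0≤^ k 0≤y)))) ⟩
    x ℚ.* (X ℚ.+ n ℚ.* (h ℚ.* y ^ℚ k)) ℚ.+ h ℚ.* Y ℚ.+ n ℚ.* (h ℚ.* (h ℚ.* y ^ℚ k))
      ≡⟨ solve 5 (λ x h X n Yₖ → x :* (X :+ n :* (h :* Yₖ)) :+ h :* ((x :+ h) :* Yₖ) :+ n :* (h :* (h :* Yₖ))
                               := x :* X :+ (n :+ con 1ℚ) :* (h :* ((x :+ h) :* Yₖ))) refl x h X n (y ^ℚ k) ⟩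
    x ℚ.* X ℚ.+ (n ℚ.+ 1ℚ) ℚ.* (h ℚ.* Y)
      ≡⟨ cong (λ c → x ℚ.* X ℚ.+ c ℚ.* (h ℚ.* Y)) (/-suc (suc k) 1) ⟨
    x ℚ.* X ℚ.+ ι (suc (suc k)) ℚ.* (h ℚ.* Y) ∎
    where
    X = x ^ℚ suc k
    Y = y ^ℚ suc k
    n = ι (suc k)

  -- The truncated form of eʸ - eˣ ≤ h eʸ, summed term by term from `^-increment`. Since (k + 1) /
  -- (k + 1)! = 1 / k!, the partial sum on the right is one term shorter.
  exp-increment : ∀ n → exp y (suc n) ℚ.≤ exp x (suc n) ℚ.+ h ℚ.* exp y n
  exp-increment zero = ℚ.≤-reflexive (solve 1 (λ h → con 0ℚ :+ con 1ℚ :* con 1ℚ := con 0ℚ :+ con 1ℚ :* con 1ℚ :+ h :* con 0ℚ) refl h)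
  exp-increment (suc n) = begin
    exp y (suc n) ℚ.+ y ^ℚ suc n ℚ.* c
      ≤⟨ ℚ.+-mono-≤ (exp-increment n) (ℚ.*-monoʳ-≤-nonNeg c {{ℚ.normalize-nonNeg 1 (suc n !) {{suc n ℕ.!≢0}}}} (^-increment n)) ⟩
    exp x (suc n) ℚ.+ h ℚ.* exp y n ℚ.+ (x ^ℚ suc n ℚ.+ ι (suc n) ℚ.* (h ℚ.* y ^ℚ n)) ℚ.* c
      ≡⟨ solve 7 (λ Sx Sy h X i Y c → Sx :+ h :* Sy :+ (X :+ i :* (h :* Y)) :* c
                                    := Sx :+ X :* c :+ h :* (Sy :+ Y :* (i :* c))) refl
           (exp x (suc n)) (exp y n) h (x ^ℚ suc n) (ι (suc n)) (y ^ℚ n) c ⟩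
    exp x (suc n) ℚ.+ x ^ℚ suc n ℚ.* c ℚ.+ h ℚ.* (exp y n ℚ.+ y ^ℚ n ℚ.* (ι (suc n) ℚ.* c))
      ≡⟨ cong (λ d → exp x (suc n) ℚ.+ x ^ℚ suc n ℚ.* c ℚ.+ h ℚ.* (exp y n ℚ.+ y ^ℚ n ℚ.* d)) (1/!-suc n) ⟩
    exp x (suc (suc n)) ℚ.+ h ℚ.* exp y (suc n) ∎
    where c = (+ 1 / (suc n !)) {{suc n ℕ.!≢0}}

exp-step : ∀ {x} → 0ℚ ℚ.≤ x → ∀ n → exp x n ℚ.≤ exp x (suc n)
exp-step {x} 0≤x n = p≤p+q (exp x n) (0≤* (0≤^ n 0≤x) (0≤/ 1 (n !) {{n ℕ.!≢0}}))

-- From S(x + h) − S(x) ≤ h S(x + h) one gets S(x + h) ≤ S(x) / (1 − h); here h = 1/72.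
exp-upper : ∀ δ n → exp (+ δ / 72) n ℚ.≤ (+ 72 / 71) ^ℚ δ
exp-upper zero zero = 0≤/ 1 1
exp-upper zero (suc n) = ℚ.≤-reflexive (exp-0 n)
  where
  exp-0 : ∀ n → exp 0ℚ (suc n) ≡ 1ℚ
  exp-0 zero    = refl
  exp-0 (suc n) = cong₂ ℚ._+_ (exp-0 n) (trans (cong (ℚ._* c) (ℚ.*-zeroˡ (0ℚ ^ℚ n))) (ℚ.*-zeroˡ c))
    where c = (+ 1 / (suc n !)) {{suc n ℕ.!≢0}}
exp-upper (suc δ) n = begin
  exp (+ suc δ / 72) n  ≡⟨ cong (λ z → exp z n) (/-suc δ 72) ⟩
  exp y n               ≡⟨ solve 1 (λ S → S := con (+ 72 / 71) :* (S :- con h :* S)) refl (exp y n) ⟩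
  + 72 / 71 ℚ.* (exp y n ℚ.- h ℚ.* exp y n)
    ≤⟨ ℚ.*-monoˡ-≤-nonNeg (+ 72 / 71) (begin
      exp y n ℚ.- h ℚ.* exp y n
        -- Lengthening the partial sum by one term first makes the shorter sum produced by
        -- `exp-increment` cancel exactly. The induction on δ therefore needs its hypothesis at
        -- `suc n`.
        ≤⟨ ℚ.+-monoˡ-≤ (ℚ.- (h ℚ.* exp y n)) (ℚ.≤-trans (exp-step 0≤y n) (exp-increment (0≤/ δ 72) (0≤/ 1 72) n)) ⟩
      exp x (suc n) ℚ.+ h ℚ.* exp y n ℚ.- h ℚ.* exp y n
        ≡⟨ solve 2 (λ a b → a :+ b :- b := a) refl (exp x (suc n)) (h ℚ.* exp y n) ⟩
      exp x (suc n)
        ≤⟨ exp-upper δ (suc n) ⟩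
      (+ 72 / 71) ^ℚ δ ∎) ⟩
  + 72 / 71 ℚ.* (+ 72 / 71) ^ℚ δ ∎
  where
  open ℚ.≤-Reasoning
  open +-*-Solver
  x = + δ / 72
  h = + 1 / 72
  y = x ℚ.+ h
  0≤y = 0≤+ (0≤/ δ 72) (0≤/ 1 72)

-- If B < q, take r strictly between them: the tolerance ε = r - B forces q ≤ B + ε = r, a
-- contradiction.
≤lim⇒≤ : ∀ {q a B} → q ≤lim a → (∀ n → a n ℚ.≤ B) → q ℚ.≤ B
≤lim⇒≤ {q} {a} {B} q≤lim a≤B with q ℚ.≤? B
... | yes q≤B = q≤B
... | no  q≰B with ℚ.<-dense (ℚ.≰⇒> q≰B)
... | r , B<r , r<q with q≤lim (r ℚ.- B) (subst (ℚ._< r ℚ.- B) (ℚ.+-inverseʳ B) (ℚ.+-monoˡ-< (ℚ.- B) B<r))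
... | N , q≤ = contradiction (ℚ.<-≤-trans r<q (begin
  q                        ≤⟨ q≤ N ℕ.≤-refl ⟩
  a N ℚ.+ (r ℚ.- B)        ≤⟨ ℚ.+-monoˡ-≤ (r ℚ.- B) (a≤B N) ⟩
  B ℚ.+ (r ℚ.- B)          ≡⟨ solve 2 (λ r B → B :+ (r :- B) := r) refl r B ⟩
  r                        ∎)) (ℚ.<-irrefl refl)
  where
  open ℚ.≤-Reasoning
  open +-*-Solver

ι-72/71 : ∀ n → ι (71 ℕ.^ n) ℚ.* (+ 72 / 71) ^ℚ n ≡ ι (72 ℕ.^ n)
ι-72/71 zero    = refl
ι-72/71 (suc n) = begin
  ι (71 ℕ.* 71 ℕ.^ n) ℚ.* (r ℚ.* r ^ℚ n)      ≡⟨ cong (ℚ._* (r ℚ.* r ^ℚ n)) (ι-* 71 (71 ℕ.^ n)) ⟩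
  ι 71 ℚ.* ι (71 ℕ.^ n) ℚ.* (r ℚ.* r ^ℚ n)
    ≡⟨ solve 2 (λ a b → con (ι 71) :* a :* (con r :* b)  := con (ι 72) :* (a :* b)) refl
         (ι (71 ℕ.^ n)) (r ^ℚ n) ⟩
  ι 72 ℚ.* (ι (71 ℕ.^ n) ℚ.* r ^ℚ n)          ≡⟨ cong (ι 72 ℚ.*_) (ι-72/71 n) ⟩
  ι 72 ℚ.* ι (72 ℕ.^ n)                       ≡⟨ ι-* 72 (72 ℕ.^ n) ⟨
  ι (72 ℕ.* 72 ℕ.^ n)                         ∎
  where
  open ≡-Reasoning
  open +-*-Solver
  r = + 72 / 71

-- Passes from the real hypothesis to natural numbers: bounding exp (δ/72) by (72/71) ^ δ turns it
-- into 12 δ Δ ≤ (72/71) ^ δ.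
inDegreeBound⇒≤ : ∀ Δ δ .{{_ : ℕ.NonZero δ}} → ι Δ ≤lim inDegreeBound δ →
                  71 ℕ.^ δ ℕ.* (12 ℕ.* δ ℕ.* Δ) ℕ.≤ 72 ℕ.^ δ
inDegreeBound⇒≤ Δ δ Δ≤lim = ι-cancel-≤ (begin
  ι (71 ℕ.^ δ ℕ.* (12 ℕ.* δ ℕ.* Δ))                   ≡⟨ ι-* (71 ℕ.^ δ) (12 ℕ.* δ ℕ.* Δ) ⟩
  ι (71 ℕ.^ δ) ℚ.* ι (12 ℕ.* δ ℕ.* Δ)
    ≤⟨ ℚ.*-monoˡ-≤-nonNeg (ι (71 ℕ.^ δ)) {{ℚ.normalize-nonNeg (71 ℕ.^ δ) 1}} (begin
    ι (12 ℕ.* δ ℕ.* Δ)                ≡⟨ ι-* (12 ℕ.* δ) Δ ⟩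
    ι (12 ℕ.* δ) ℚ.* ι Δ              ≤⟨ ℚ.*-monoˡ-≤-nonNeg (ι (12 ℕ.* δ)) {{ℚ.normalize-nonNeg (12 ℕ.* δ) 1}}
      (≤lim⇒≤ Δ≤lim (λ n → ℚ.*-monoʳ-≤-nonNeg c {{ℚ.normalize-nonNeg 1 (12 ℕ.* δ)}} (exp-upper δ n))) ⟩
    ι (12 ℕ.* δ) ℚ.* (r ^ℚ δ ℚ.* c)   ≡⟨ solve 3 (λ i p c → i :* (p :* c) := p :* (i :* c)) refl (ι (12 ℕ.* δ)) (r ^ℚ δ) c ⟩
    r ^ℚ δ ℚ.* (ι (12 ℕ.* δ) ℚ.* c)   ≡⟨ cong (r ^ℚ δ ℚ.*_) (ι-*-1/′ (12 ℕ.* δ)) ⟩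
    r ^ℚ δ ℚ.* 1ℚ                     ≡⟨ ℚ.*-identityʳ (r ^ℚ δ) ⟩
    r ^ℚ δ                            ∎) ⟩
  ι (71 ℕ.^ δ) ℚ.* r ^ℚ δ                             ≡⟨ ι-72/71 δ ⟩
  ι (72 ℕ.^ δ)                                        ∎)
  where
  open ℚ.≤-Reasoning
  open +-*-Solver
  instance
    12δ≢0 = ℕ.m*n≢0 12 δ
  r = + 72 / 71
  c = + 1 / (12 ℕ.* δ)
  ι-*-1/′ : ∀ m .{{_ : ℕ.NonZero m}} → ι m ℚ.* (+ 1 / m) ≡ 1ℚ
  ι-*-1/′ m = trans (cong (ι m ℚ.*_) (ℚ./-cong {+ 1} {m} {+ 1} {m ℕ.* 1} {{it}} {{ℕ.m*n≢0 m 1}}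
    refl (sym (ℕ.*-identityʳ m)))) (ι-*-1/ m 1)

-- Tail bound for one out-neighbourhood

^-distribʳ-* : ∀ d a b → (a * b) ^ d ≡ a ^ d * b ^ d
^-distribʳ-* zero    a b = refl
^-distribʳ-* (suc d) a b = trans (cong (a * b *_) (^-distribʳ-* d a b)) (*-interchange a b (a ^ d) (b ^ d))

total-sum : ∀ {j k n} (F : Fin j → Vec (Fin k) n → ℕ) →
            total (λ χ → sum (λ c → F c χ)) ≡ sum (λ c → total (F c))
total-sum {zero} {k} {n} F = total-* {k} {n} 0 (λ _ → 0)
total-sum {suc j}        F = trans (total-+ (F zero) (λ χ → sum (λ c → F (suc c) χ)))
  (cong (λ t → total (F zero) + t) (total-sum (F ∘ suc)))

class : ∀ {k n} → Vec (Fin k) n → Fin k → Subset n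
class χ c = tabulate (λ u → does (lookup χ u Fin.≟ c))

-- The moment is E[t^(2X − d)] with t = 3/2, close to the optimal √2: an out-neighbour contributes
-- t² = 9/4 if it has colour c and 1 otherwise. Scaling by 4 gives 9 and 4, with 17 = 9 + 4 + 4.
tilt : ∀ {k} → Fin k → Fin k → ℕ
tilt c x = if does (x Fin.≟ c) then 9 else 4

sum-tilt : ∀ c → sum (tilt {3} c) ≡ 17
sum-tilt zero             = refl
sum-tilt (suc zero)       = refl
sum-tilt (suc (suc zero)) = refl

-- The weight is 9 ^ X · 4 ^ (∣ D ∣ - X); the factor 4 ^ X on the left avoids the subtraction.
weight-tilt : ∀ {k n} (c : Fin k) (D : Subset n) χ →
              let X = ∣ D ∩ class χ c ∣ in weight (tilt c) D χ * 4 ^ X ≡ 9 ^ X * 4 ^ ∣ D ∣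
weight-tilt c []          []      = refl
weight-tilt c (false ∷ D) (x ∷ χ) = weight-tilt c D χ
weight-tilt c (true ∷ D)  (x ∷ χ) with does (x Fin.≟ c)
... | true  = begin
  9 * w * (4 * 4 ^ X)        ≡⟨ l 9 w 4 (4 ^ X) ⟩
  9 * 4 * (w * 4 ^ X)        ≡⟨ cong (9 * 4 *_) (weight-tilt c D χ) ⟩
  9 * 4 * (9 ^ X * 4 ^ ∣ D ∣) ≡⟨ l 9 (9 ^ X) 4 (4 ^ ∣ D ∣) ⟨
  9 * 9 ^ X * (4 * 4 ^ ∣ D ∣) ∎
  where
  open ≡-Reasoning
  X = ∣ D ∩ class χ c ∣
  w = weight (tilt c) D χ
  l : ∀ a b c d → a * b * (c * d) ≡ a * c * (b * d)
  l = solve-∀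
... | false = begin
  4 * w * 4 ^ X          ≡⟨ *-assoc 4 w _ ⟩
  4 * (w * 4 ^ X)        ≡⟨ cong (4 *_) (weight-tilt c D χ) ⟩
  4 * (9 ^ X * 4 ^ ∣ D ∣) ≡⟨ l 4 (9 ^ X) (4 ^ ∣ D ∣) ⟩
  9 ^ X * (4 * 4 ^ ∣ D ∣) ∎
  where
  open ≡-Reasoning
  X = ∣ D ∩ class χ c ∣
  w = weight (tilt c) D χ
  l : ∀ a b c → a * (b * c) ≡ b * (a * c)
  l = solve-∀

-- With d = ∣ D ∣ the weight equals 6 ^ d · (3/2) ^ (2X - d), and the exponent 2X - d is
-- nonnegative.
weight-overfull : ∀ {k n} (c : Fin k) (D : Subset n) χ → ∣ D ∣ ≤ 2 * ∣ D ∩ class χ c ∣ →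
                  6 ^ ∣ D ∣ ≤ weight (tilt c) D χ
weight-overfull c D χ d≤2X = *-cancelʳ-≤ _ _ (4 ^ X) {{m^n≢0 4 X}} (begin
  6 ^ d * 4 ^ X                  ≡⟨ cong (6 ^ d *_) (^-*-assoc 2 2 X) ⟩
  6 ^ d * 2 ^ (2 * X)            ≡⟨ cong (λ e → 6 ^ d * 2 ^ e) (sym 2X≡) ⟩
  6 ^ d * 2 ^ (e + d)            ≡⟨ cong (6 ^ d *_) (^-distribˡ-+-* 2 e d) ⟩
  6 ^ d * (2 ^ e * 2 ^ d)        ≤⟨ *-monoʳ-≤ (6 ^ d) (*-monoˡ-≤ (2 ^ d) (^-monoˡ-≤ e (s≤s (s≤s (z≤n {1}))))) ⟩
  6 ^ d * (3 ^ e * 2 ^ d)        ≡⟨ cong (_* (3 ^ e * 2 ^ d)) (^-distribʳ-* d 3 2) ⟩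
  3 ^ d * 2 ^ d * (3 ^ e * 2 ^ d) ≡⟨ l (3 ^ d) (2 ^ d) (3 ^ e) ⟩
  3 ^ e * 3 ^ d * (2 ^ d * 2 ^ d) ≡⟨ cong₂ _*_ (sym (^-distribˡ-+-* 3 e d)) (sym (^-distribʳ-* d 2 2)) ⟩
  3 ^ (e + d) * 4 ^ d            ≡⟨ cong (λ e → 3 ^ e * 4 ^ d) 2X≡ ⟩
  3 ^ (2 * X) * 4 ^ d            ≡⟨ cong (_* 4 ^ d) (sym (^-*-assoc 3 2 X)) ⟩
  9 ^ X * 4 ^ d                  ≡⟨ weight-tilt c D χ ⟨
  weight (tilt c) D χ * 4 ^ X    ∎)
  where
  open ≤-Reasoning
  X = ∣ D ∩ class χ c ∣
  d = ∣ D ∣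
  e = 2 * X ∸ d
  2X≡ : e + d ≡ 2 * X
  2X≡ = m∸n+n≡m d≤2X
  l : ∀ a b c → a * b * (c * b) ≡ c * a * (b * b)
  l = solve-∀

-- Markov's inequality with a union bound over three colours: a bad colouring has weight at least 6
-- ^ d for some colour, while the mean weight for each colour is (17/3) ^ d. The quotient is (17/18)
-- ^ d, and the weights are independent of g.
chernoff : ∀ {n} (D : Subset n) (bad : Vec (Fin 3) n → Bool) →
           (∀ χ → bad χ ≡ true → ∃[ c ] ∣ D ∣ ≤ 2 * ∣ D ∩ class χ c ∣) →
           ∀ {g} → Ignores D g → 18 ^ ∣ D ∣ * total (λ χ → 𝟙 (bad χ) * g χ) ≤ 3 * 17 ^ ∣ D ∣ * total g
chernoff D bad overfull {g} ign = begin
  18 ^ d * total (λ χ → 𝟙 (bad χ) * g χ)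
    ≡⟨ cong (_* total (λ χ → 𝟙 (bad χ) * g χ)) (^-distribʳ-* d 3 6) ⟩
  3 ^ d * 6 ^ d * total (λ χ → 𝟙 (bad χ) * g χ)
    ≡⟨ *-assoc (3 ^ d) (6 ^ d) _ ⟩
  3 ^ d * (6 ^ d * total (λ χ → 𝟙 (bad χ) * g χ))
    ≡⟨ cong (3 ^ d *_) (total-* (6 ^ d) (λ χ → 𝟙 (bad χ) * g χ)) ⟨
  3 ^ d * total (λ χ → 6 ^ d * (𝟙 (bad χ) * g χ))
    ≤⟨ *-monoʳ-≤ (3 ^ d) (total-mono pointwise) ⟩
  3 ^ d * total (λ χ → sum (λ c → W c χ * g χ))
    ≡⟨ cong (3 ^ d *_) (total-sum (λ c χ → W c χ * g χ)) ⟩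
  3 ^ d * sum (λ c → total (λ χ → W c χ * g χ))
    ≡⟨ *-distribˡ-sum (3 ^ d) (λ c → total (λ χ → W c χ * g χ)) ⟩
  sum (λ c → 3 ^ d * total (λ χ → W c χ * g χ))
    ≡⟨ sum-cong-≗ (λ c → trans (total-weight (tilt c) D ign) (cong (λ s → s ^ d * total g) (sum-tilt c))) ⟩
  sum {3} (λ _ → 17 ^ d * total g)
    ≡⟨ sum-const 3 (17 ^ d * total g) ⟩
  3 * (17 ^ d * total g)
    ≡⟨ *-assoc 3 (17 ^ d) (total g) ⟨
  3 * 17 ^ d * total g ∎
  where
  open ≤-Reasoning
  d = ∣ D ∣
  W : Fin 3 → Vec (Fin 3) _ → ℕ
  W c χ = weight (tilt c) D χ
  pointwise : ∀ χ → 6 ^ d * (𝟙 (bad χ) * g χ) ≤ sum (λ c → W c χ * g χ)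
  pointwise χ with bad χ in eq
  ... | false = subst (_≤ sum (λ c → W c χ * g χ)) (sym (*-zeroʳ (6 ^ d))) z≤n
  ... | true with c , d≤2X ← overfull χ eq = begin
    6 ^ d * (1 * g χ)          ≡⟨ cong (6 ^ d *_) (*-identityˡ (g χ)) ⟩
    6 ^ d * g χ                ≤⟨ *-monoˡ-≤ (g χ) (weight-overfull c D χ d≤2X) ⟩
    W c χ * g χ                ≤⟨ term≤sum (λ c → W c χ * g χ) c ⟩
    sum (λ c → W c χ * g χ)    ∎
    where
    term≤sum : ∀ {k} (f : Fin k → ℕ) c → f c ≤ sum f
    term≤sum f zero    = m≤m+n _ _
    term≤sum f (suc c) = ≤-trans (term≤sum (f ∘ suc) c) (m≤n+m _ _)

-- Numerical condition of the local lemma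

-- Bernoulli's inequality (1 − 1/M)ᵏ ≥ 1 − k/M for M = 1 + m, cleared of denominators and subtraction.
bernoulli : ∀ m k → suc m * suc m ^ k ≤ suc m * m ^ k + k * suc m ^ k
bernoulli m zero    = m≤m+n _ _
bernoulli m (suc k) = begin
  M * (M * M ^ k)                        ≤⟨ *-monoʳ-≤ M (bernoulli m k) ⟩
  M * (M * m ^ k + k * M ^ k)            ≡⟨ l₁ m k (m ^ k) (M ^ k) ⟩
  M * (m * m ^ k) + M * m ^ k + k * (M * M ^ k)
    ≤⟨ +-monoˡ-≤ (k * (M * M ^ k)) (+-monoʳ-≤ (M * (m * m ^ k)) (*-monoʳ-≤ M (^-monoˡ-≤ k (n≤1+n m)))) ⟩
  M * (m * m ^ k) + M * M ^ k + k * (M * M ^ k)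
    ≡⟨ +-assoc (M * (m * m ^ k)) _ _ ⟩
  M * (m * m ^ k) + suc k * (M * M ^ k) ∎
  where
  open ≤-Reasoning
  M = suc m
  l₁ : ∀ m k a b → suc m * (suc m * a + k * b) ≡ suc m * (m * a) + suc m * a + k * (suc m * b)
  l₁ = solve-∀

module _ {Δ m : ℕ} .{{_ : NonZero Δ}} (M≡72Δ : suc m ≡ 72 * Δ) where

  open ≤-Reasoning

  -- Bernoulli's inequality with Δ / M = 1/72.
  decay : 71 * suc m ^ Δ ≤ 72 * m ^ Δ
  decay = *-cancelˡ-≤ Δ (+-cancelʳ-≤ (Δ * suc m ^ Δ) _ _ (begin
    Δ * (71 * suc m ^ Δ) + Δ * suc m ^ Δ   ≡⟨ l Δ (suc m ^ Δ) ⟩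
    72 * Δ * suc m ^ Δ                     ≡⟨ cong (_* suc m ^ Δ) M≡72Δ ⟨
    suc m * suc m ^ Δ                      ≤⟨ bernoulli m Δ ⟩
    suc m * m ^ Δ + Δ * suc m ^ Δ          ≡⟨ cong (λ M → M * m ^ Δ + Δ * suc m ^ Δ) M≡72Δ ⟩
    72 * Δ * m ^ Δ + Δ * suc m ^ Δ         ≡⟨ cong (_+ Δ * suc m ^ Δ) (l′ Δ (m ^ Δ)) ⟩
    Δ * (72 * m ^ Δ) + Δ * suc m ^ Δ       ∎))
    where
    l : ∀ Δ a → Δ * (71 * a) + Δ * a ≡ 72 * Δ * a
    l = solve-∀
    l′ : ∀ Δ a → 72 * Δ * a ≡ Δ * (72 * a)
    l′ = solve-∀

  decay-^ : ∀ d → 71 ^ d * suc m ^ (d * Δ) ≤ 72 ^ d * m ^ (d * Δ)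
  decay-^ d = subst₂ _≤_ (eq 71 (suc m)) (eq 72 m) (^-monoˡ-≤ d decay)
    where
    eq : ∀ a b → (a * b ^ Δ) ^ d ≡ a ^ d * b ^ (d * Δ)
    eq a b = trans (^-distribʳ-* d a (b ^ Δ))
      (cong (a ^ d *_) (trans (^-*-assoc b Δ d) (cong (b ^_) (*-comm Δ d))))

  -- Two factors (72/71) ^ d have to be paid for, one from 3 M ≤ (72/71) ^ d and one from `decay-^`;
  -- the factor (17/18) ^ d of the tail outweighs both.
  rarity : ∀ {d X N} → 3 * suc m * 71 ^ d ≤ 72 ^ d → 18 ^ d * X ≤ 3 * 17 ^ d * N →
           suc m * suc m ^ (d * Δ) * X ≤ m ^ (d * Δ) * N
  rarity {d} {X} {N} few tail = *-cancelˡ-≤ (18 ^ d * 71 ^ d * 71 ^ d) {{C≢0}} (begin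
    18 ^ d * 71 ^ d * 71 ^ d * (suc m * P * X)
      ≡⟨ l₁ (18 ^ d) (71 ^ d) (suc m) P X ⟩
    (71 ^ d * P) * (suc m * 71 ^ d) * (18 ^ d * X)
      ≤⟨ *-mono-≤ (*-monoˡ-≤ (suc m * 71 ^ d) (decay-^ d)) tail ⟩
    (72 ^ d * Q) * (suc m * 71 ^ d) * (3 * 17 ^ d * N)
      ≡⟨ l₂ (72 ^ d) Q (suc m) (71 ^ d) (17 ^ d) N ⟩
    3 * suc m * 71 ^ d * (17 ^ d * 72 ^ d * (Q * N))
      ≤⟨ *-monoˡ-≤ (17 ^ d * 72 ^ d * (Q * N)) few ⟩
    72 ^ d * (17 ^ d * 72 ^ d * (Q * N))
      ≡⟨ l₃ (72 ^ d) (17 ^ d) (Q * N) ⟩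
    17 ^ d * 72 ^ d * 72 ^ d * (Q * N)
      -- The constants are 88128 = 17 · 72² and 90738 = 18 · 71².
      ≤⟨ *-monoˡ-≤ (Q * N) (subst₂ _≤_ (eq 17 72 72) (eq 18 71 71) (^-monoˡ-≤ d (≤ᵇ⇒≤ 88128 90738 _))) ⟩
    18 ^ d * 71 ^ d * 71 ^ d * (Q * N) ∎)
    where
    P = suc m ^ (d * Δ)
    Q = m ^ (d * Δ)
    C≢0 : NonZero (18 ^ d * 71 ^ d * 71 ^ d)
    C≢0 = m*n≢0 _ _ {{m*n≢0 _ _ {{m^n≢0 18 d}} {{m^n≢0 71 d}}}} {{m^n≢0 71 d}}
    eq : ∀ a b c → (a * b * c) ^ d ≡ a ^ d * b ^ d * c ^ d
    eq a b c = trans (^-distribʳ-* d (a * b) c) (cong (_* c ^ d) (^-distribʳ-* d a b))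
    l₁ : ∀ a b M P X → a * b * b * (M * P * X) ≡ (b * P) * (M * b) * (a * X)
    l₁ = solve-∀
    l₂ : ∀ a Q M b c N → (a * Q) * (M * b) * (3 * c * N) ≡ 3 * M * b * (c * a * (Q * N))
    l₂ = solve-∀
    l₃ : ∀ a b c → a * (b * a * c) ≡ b * a * a * c
    l₃ = solve-∀

-- The condition 18 ≤ δ enters through 3 · 72 = 12 · 18. Passing from δ to d is possible because
-- (72/71) ^ d increases with d.
few-in-neighbours : ∀ {Δ δ d} → 18 ≤ δ → δ ≤ d → 71 ^ δ * (12 * δ * Δ) ≤ 72 ^ δ →
                    3 * (72 * Δ) * 71 ^ d ≤ 72 ^ d
few-in-neighbours {Δ} {δ} {d} 18≤δ δ≤d bound = begin
  3 * (72 * Δ) * 71 ^ d                ≡⟨ l₁ Δ (71 ^ d) ⟩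
  12 * 18 * Δ * 71 ^ d                 ≤⟨ *-monoˡ-≤ (71 ^ d) (*-monoˡ-≤ Δ (*-monoʳ-≤ 12 18≤δ)) ⟩
  12 * δ * Δ * 71 ^ d                  ≡⟨ cong (12 * δ * Δ *_) (split 71) ⟩
  12 * δ * Δ * (71 ^ r * 71 ^ δ)       ≡⟨ l₂ (12 * δ * Δ) (71 ^ r) (71 ^ δ) ⟩
  71 ^ r * (71 ^ δ * (12 * δ * Δ))     ≤⟨ *-mono-≤ (^-monoˡ-≤ r (n≤1+n 71)) bound ⟩
  72 ^ r * 72 ^ δ                      ≡⟨ split 72 ⟨
  72 ^ d                               ∎
  where
  open ≤-Reasoning
  r = d ∸ δ
  split : ∀ a → a ^ d ≡ a ^ r * a ^ δ
  split a = trans (cong (a ^_) (sym (m∸n+n≡m δ≤d))) (^-distribˡ-+-* a r δ)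
  l₁ : ∀ Δ a → 3 * (72 * Δ) * a ≡ 12 * 18 * Δ * a
  l₁ = solve-∀
  l₂ : ∀ a b c → a * (b * c) ≡ b * (c * a)
  l₂ = solve-∀

-- Digraphs

∣∷∣ : ∀ {n} b (p : Subset n) → ∣ b ∷ p ∣ ≡ 𝟙 b + ∣ p ∣
∣∷∣ true  p = refl
∣∷∣ false p = refl

∣tabulate∣ : ∀ {n} (f : Fin n → Bool) → ∣ tabulate f ∣ ≡ sumᴸ (List.map (𝟙 ∘ f) (allFin n))
∣tabulate∣ f = trans (aux f) (cong sumᴸ (sym (map-tabulate id (𝟙 ∘ f))))
  where
  aux : ∀ {n} (f : Fin n → Bool) → ∣ tabulate f ∣ ≡ sumᴸ (List.tabulate (𝟙 ∘ f))
  aux {zero}  f = refl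
  aux {suc n} f = trans (∣∷∣ (f zero) (tabulate (f ∘ suc))) (cong (λ t → 𝟙 (f zero) + t) (aux (f ∘ suc)))

sumᴸ-mono : ∀ {A : Set} {f g : A → ℕ} → (∀ x → f x ≤ g x) → ∀ xs → sumᴸ (List.map f xs) ≤ sumᴸ (List.map g xs)
sumᴸ-mono f≤g []       = z≤n
sumᴸ-mono f≤g (x ∷ xs) = +-mono-≤ (f≤g x) (sumᴸ-mono f≤g xs)

sumᴸ-+ : ∀ {A : Set} (f g : A → ℕ) xs →
         sumᴸ (List.map (λ x → f x + g x) xs) ≡ sumᴸ (List.map f xs) + sumᴸ (List.map g xs)
sumᴸ-+ f g []       = refl
sumᴸ-+ f g (x ∷ xs) = trans (cong (λ t → f x + g x + t) (sumᴸ-+ f g xs)) (l (f x) (g x) _ _)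
  where
  l : ∀ a b c d → a + b + (c + d) ≡ a + c + (b + d)
  l = solve-∀

-- The pairs (j, u) with u in `D` and `e j u` true are counted by u instead of by j, and each u
-- occurs in at most Δ of them.
double-count : ∀ {J : Set} {n Δ} (e : J → Fin n → Bool) (S : List J) →
               (∀ u → sumᴸ (List.map (λ j → 𝟙 (e j u)) S) ≤ Δ) →
               ∀ D → sumᴸ (List.map (λ j → ∣ D ∩ tabulate (e j) ∣) S) ≤ ∣ D ∣ * Δ
double-count e []      e≤Δ D  = z≤n
double-count {Δ = Δ} e (j ∷ S) e≤Δ [] = double-count {Δ = Δ} e S (λ ()) []
double-count e S e≤Δ (false ∷ D) = double-count (λ j → e j ∘ suc) S (e≤Δ ∘ suc) D
double-count {Δ = Δ} e S e≤Δ (true ∷ D) = begin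
  sumᴸ (List.map (λ j → ∣ e j zero ∷ (D ∩ tabulate (e j ∘ suc)) ∣) S)
    ≤⟨ sumᴸ-mono (λ j → ≤-reflexive (∣∷∣ (e j zero) (D ∩ tabulate (e j ∘ suc)))) S ⟩
  sumᴸ (List.map (λ j → 𝟙 (e j zero) + ∣ D ∩ tabulate (e j ∘ suc) ∣) S)
    ≡⟨ sumᴸ-+ (λ j → 𝟙 (e j zero)) (λ j → ∣ D ∩ tabulate (e j ∘ suc) ∣) S ⟩
  sumᴸ (List.map (λ j → 𝟙 (e j zero)) S) + sumᴸ (List.map (λ j → ∣ D ∩ tabulate (e j ∘ suc) ∣) S)
    ≤⟨ +-mono-≤ (e≤Δ zero) (double-count (λ j → e j ∘ suc) S (e≤Δ ∘ suc) D) ⟩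
  Δ + ∣ D ∣ * Δ ∎
  where open ≤-Reasoning

∣p∣>0 : ∀ {n} {p : Subset n} → Nonempty p → 0 < ∣ p ∣
∣p∣>0 (_ , x∈p) = ≤-trans (s≤s z≤n) (x∈p⇒∣p-x∣<∣p∣ x∈p)

∈-tabulate⁺ : ∀ {n} {f : Fin n → Bool} {i} → f i ≡ true → i ∈ tabulate f
∈-tabulate⁺ {f = f} {i} fi = lookup⇒[]= i (tabulate f) (trans (lookup∘tabulate f i) fi)

∈-tabulate⁻ : ∀ {n} {f : Fin n → Bool} {i} → i ∈ tabulate f → f i ≡ true
∈-tabulate⁻ {f = f} {i} i∈ = trans (sym (lookup∘tabulate f i)) ([]=⇒lookup i∈)

∩-tabulate-cong : ∀ {n} (D : Subset n) {f g : Fin n → Bool} → (∀ {i} → i ∈ D → f i ≡ g i) →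
                  D ∩ tabulate f ≡ D ∩ tabulate g
∩-tabulate-cong []          f≗g = refl
∩-tabulate-cong (true ∷ D)  f≗g = cong₂ _∷_ (f≗g here) (∩-tabulate-cong D (f≗g ∘ there))
∩-tabulate-cong (false ∷ D) f≗g = cong (false ∷_) (∩-tabulate-cong D (f≗g ∘ there))

does⇒ : ∀ {P : Set} (P? : Dec P) → does P? ≡ true → P
does⇒ (yes p) _ = p

not-does : ∀ {P : Set} (P? : Dec P) → not (does P?) ≡ true → ¬ P
not-does (no ¬p) _ = ¬p

𝟙-does≤ : ∀ {P : Set} {n} (P? : Dec P) → (P → 0 < n) → 𝟙 (does P?) ≤ n
𝟙-does≤ (yes p) 0<n = 0<n p
𝟙-does≤ (no _)  _   = z≤n

-- Balanced colourings of a digraph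

module _ (G : Digraph) where
  open Digraph G

  Balanced : Vertex → Vec (Fin 3) order → Set
  Balanced v χ = ∀ c → AtMostHalf (lookup χ) v c

  abstract
    balanced? : ∀ v χ → Dec (Balanced v χ)
    balanced? v χ = Fin.all? (λ c → 2 * ∣ N⁺ v ∩ class χ c ∣ ≤? deg⁺ v)

  balanced-transfer : ∀ v χ χ′ → AgreeOn (N⁺ v) χ χ′ → Balanced v χ → Balanced v χ′
  balanced-transfer v χ χ′ agree bal c = subst (λ p → 2 * ∣ p ∣ ≤ deg⁺ v)
    (∩-tabulate-cong (N⁺ v) (λ u∈ → cong (λ x → does (x Fin.≟ c)) (agree u∈))) (bal c)

  balanced-local : ∀ v χ χ′ → AgreeOn (N⁺ v) χ χ′ → does (balanced? v χ) ≡ does (balanced? v χ′)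
  balanced-local v χ χ′ agree = does-⇔
    (mk⇔ (balanced-transfer v χ χ′ agree) (balanced-transfer v χ′ χ (λ u∈ → sym (agree u∈))))
    (balanced? v χ) (balanced? v χ′)

  unbalanced : ∀ v χ → not (does (balanced? v χ)) ≡ true → ∃[ c ] ∣ N⁺ v ∣ ≤ 2 * ∣ N⁺ v ∩ class χ c ∣
  -- The strict excess over one half is weakened to the form that `chernoff` takes.
  unbalanced v χ eq = map₂ ≰⇒≥ (Fin.¬∀⟶∃¬ 3 _ (λ c → 2 * ∣ N⁺ v ∩ class χ c ∣ ≤? deg⁺ v)
    (not-does (balanced? v χ) eq))

  -- An out-neighbour of v has v as an in-neighbour, so Δ ≥ 1. This makes the weight 1 / (72 Δ)
  -- meaningful.
  in-degree≢0 : ∀ v {Δ} → 0 < deg⁺ v → (∀ u → deg⁻ u ≤ Δ) → NonZero Δ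
  in-degree≢0 v 0<deg deg⁻≤Δ with nonempty? (N⁺ v)
  ... | yes (u , u∈) = >-nonZero (≤-trans (∣p∣>0 {p = N⁻ u} (v , ∈-tabulate⁺ (∈-tabulate⁻ u∈))) (deg⁻≤Δ u))
  ... | no empty = contradiction (trans (cong ∣_∣ (Empty-unique empty)) (∣⊥∣≡0 order)) (>⇒≢ 0<deg)

  module _ {δ Δ m : ℕ} .{{_ : NonZero Δ}} (M≡72Δ : suc m ≡ 72 * Δ) (18≤δ : 18 ≤ δ)
           (δ≤deg⁺ : ∀ v → δ ≤ deg⁺ v) (deg⁻≤Δ : ∀ v → deg⁻ v ≤ Δ)
           (bound : 71 ^ δ * (12 * δ * Δ) ≤ 72 ^ δ) where

    private
      instance
        m≢0 : NonZero m
        m≢0 = >-nonZero (≤-pred (≤-trans (s≤s (s≤s z≤n)) (≤-trans (m≤m*n 72 Δ) (≤-reflexive (sym M≡72Δ)))))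

      -- There is one event per vertex, determined by the colours on its out-neighbourhood; the
      -- exponent `deg⁺ v * Δ` bounds the number of out-neighbourhoods meeting `N⁺ v`.
      open LocalLemma N⁺ (λ v χ → does (balanced? v χ)) balanced-local m (λ v → deg⁺ v * Δ)
        (λ v ign → rarity M≡72Δ {deg⁺ v}
          (subst (λ M → 3 * M * 71 ^ deg⁺ v ≤ 72 ^ deg⁺ v) (sym M≡72Δ) (few-in-neighbours {Δ} 18≤δ (δ≤deg⁺ v) bound))
          (chernoff (N⁺ v) (λ χ → not (does (balanced? v χ))) (unbalanced v) ign))

      -- Every w whose out-neighbourhood meets `N⁺ v` adds at least 1 to the sum over w of ∣ N⁺ v ∩
      -- N⁺ w ∣, and each u in `N⁺ v` is counted there deg⁻ u ≤ Δ times.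
      sparse : Sparse (allFin order)
      sparse v = ≤-trans (sumᴸ-mono meets (allFin order))
        (double-count arc (allFin order) (λ u → subst (_≤ Δ) (∣tabulate∣ (λ w → arc w u)) (deg⁻≤Δ u)) (N⁺ v))
        where
        meets : ∀ w → 𝟙 (does (meets? v w)) ≤ ∣ N⁺ v ∩ N⁺ w ∣
        meets w = 𝟙-does≤ (meets? v w) ∣p∣>0

    balanced-colouring : ∃[ χ ] (∀ v c → AtMostHalf {3} χ v c)
    balanced-colouring =
      let χ , all-ok = avoid-all (allFin order) sparse
      in  lookup χ , λ v → does⇒ (balanced? v χ) (all-ok (∈-allFin v))

theorem4 : (G : Digraph) (let open Digraph G) (δ Δ : ℕ) →
    IsMinOutDegree δ → IsMaxInDegree Δ →
    (δ≥1200 : δ ≥ 1200) →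
    (+ Δ / 1) ≤lim inDegreeBound δ {{>-nonZero (m<n⇒0<n δ≥1200)}} →
    ∃[ χ ] (IsMajority {3} χ × (∀ (v : Vertex) (c : Fin 3) → AtMostHalf χ v c))
theorem4 G δ Δ (δ≤deg⁺ , v₀ , _) (deg⁻≤Δ , _) δ≥1200 lim =
  -- Here m = 72 Δ - 1, so that 1 / (m + 1) is the weight 1 / M with M = 72 Δ.
  let χ , half = balanced-colouring G (suc-pred (72 * Δ)) (≤-trans (≤ᵇ⇒≤ 18 1200 _) δ≥1200)
                   δ≤deg⁺ deg⁻≤Δ (inDegreeBound⇒≤ Δ δ lim)
  -- The majority condition is the case c = χ v.
  in  χ , (λ v → half v (χ v)) , half
  where
  0<δ : 0 < δ
  0<δ = m<n⇒0<n δ≥1200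
  instance
    δ≢0 : NonZero δ
    δ≢0 = >-nonZero 0<δ
    Δ≢0 : NonZero Δ
    Δ≢0 = in-degree≢0 G v₀ (≤-trans 0<δ (δ≤deg⁺ v₀)) deg⁻≤Δ
    72Δ≢0 : NonZero (72 * Δ)
    72Δ≢0 = m*n≢0 72 Δ {{it}} {{Δ≢0}}
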